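{- Let $X$ be a $T_0$ space that is $\operatorname{Irr}$-continuous and $k$-bounded sober. Then $\ll_{\operatorname{Irr}}$ has the interpolation property: whenever $z\ll_{\operatorname{Irr}} x$, there exists $y\in X$ with $z\ll_{\operatorname{Irr}} y\ll_{\operatorname{Irr}} x$.
   Context: For a topological space $X$, a nonempty subset $E$ is irreducible if whenever $E\subseteq A_1\cup A_2$ with $A_1,A_2$ closed, $E\subseteq A_1$ or $E\subseteq A_2$. The specialisation order is $x\le y$ iff $x\in\operatorname{cl}(\{y\})$; $\uparrow x=\{z:z\ge x\}$; $\bigvee$ denotes supremum in this order. $\operatorname{Irr}^+(X)$ is the set of irreducible subsets whose supremum exists. $X$ is $k$-bounded sober if every closed set $F\in\operatorname{Irr}^+(X)$ is the closure of a unique singleton. $x\ll_{\operatorname{Irr}} y$ iff for every $E\in\operatorname{Irr}^+(X)$ with $\bigvee E\ge y$, $E\cap\uparrow x\ne\emptyset$; $\twoheaddownarrow_{\operatorname{Irr}} x=\{y:y\ll_{\operatorname{Irr}} x\}$. $X$ is $\operatorname{Irr}$-continuous if for every $x$, $\twoheaddownarrow_{\operatorname{Irr}} x$ is irreducible and $x=\bigvee\twoheaddownarrow_{\operatorname{Irr}} x$. -}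

module Defs where

open import Level using (Level; _⊔_; suc)
open import Data.Product using (∃; ∃!; ∃-syntax; _×_; proj₁; proj₂)
open import Data.Sum using (_⊎_)
open import Relation.Binary.Core using (Rel)
open import Relation.Binary.PropositionalEquality using (_≡_; _≢_)
open import Relation.Unary using (Pred; _∈_; _∉_; _⊆_; _≐_; _∩_; _∪_; ∁; ⋃; ｛_｝; Satisfiable)
open import Relation.Unary.Polymorphic using (U)

-- A subset of X is a predicate `Pred Carrier ℓ`, and equality of subsets is
-- `_≐_`, so the axioms have to say that openness respects `_≐_`.
-- Unions range over families indexed by `I : Set ℓ` (the empty family gives ∅).
-- Under excluded middle this covers every collection of open sets: up to `_≐_`
-- every subset comes from some `Carrier → Bool`, which lives in `Set ℓ`.
record TopologicalSpace (ℓ o : Level) : Set (suc (ℓ ⊔ o)) where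
  field
    Carrier   : Set ℓ
    IsOpen    : Pred (Pred Carrier ℓ) o
    open-resp : ∀ {V W} → V ≐ W → IsOpen V → IsOpen W
    U-open    : IsOpen U
    ∩-open    : ∀ {V W} → IsOpen V → IsOpen W → IsOpen (V ∩ W)
    ⋃-open    : (I : Set ℓ) (V : I → Pred Carrier ℓ) →
                (∀ i → IsOpen (V i)) → IsOpen (⋃ I V)

module _ {ℓ o : Level} (X : TopologicalSpace ℓ o) where
  open TopologicalSpace X

  IsClosed : Pred (Pred Carrier ℓ) o
  IsClosed A = IsOpen (∁ A)

  IsT₀ : Set (suc ℓ ⊔ o)
  IsT₀ = ∀ x y → x ≢ y →
         ∃[ V ] (IsOpen V × ((x ∈ V × y ∉ V) ⊎ (y ∈ V × x ∉ V)))

  -- The intersection of all closed supersets.  As it quantifies over subsets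
  -- of X, it is a predicate one universe up; the same happens to _≤_, ↑, _≪_
  -- and ↡ below, which is why the notions below that take a set E allow it to
  -- live at any level e.
  cl : ∀ {e} → Pred Carrier e → Pred Carrier (suc ℓ ⊔ o ⊔ e)
  cl E x = ∀ A → IsClosed A → E ⊆ A → x ∈ A

  _≤_ : Rel Carrier (suc ℓ ⊔ o)
  x ≤ y = x ∈ cl ｛ y ｝

  ↑ : Carrier → Pred Carrier (suc ℓ ⊔ o)
  ↑ x z = x ≤ z

  IsIrreducible : ∀ {e} → Pred Carrier e → Set (suc ℓ ⊔ o ⊔ e)
  IsIrreducible E = Satisfiable E ×
    (∀ A₁ A₂ → IsClosed A₁ → IsClosed A₂ → E ⊆ A₁ ∪ A₂ → E ⊆ A₁ ⊎ E ⊆ A₂)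

  IsSup : ∀ {e} → Pred Carrier e → Carrier → Set (suc ℓ ⊔ o ⊔ e)
  IsSup E s = (∀ x → x ∈ E → x ≤ s) ×
              (∀ u → (∀ x → x ∈ E → x ≤ u) → s ≤ u)

  Irr⁺ : Pred (Pred Carrier ℓ) (suc ℓ ⊔ o)
  Irr⁺ E = IsIrreducible E × ∃ (IsSup E)

  ⋁ : ∀ {E} → E ∈ Irr⁺ → Carrier
  ⋁ E∈Irr⁺ = proj₁ (proj₂ E∈Irr⁺)

  IsKBoundedSober : Set (suc ℓ ⊔ o)
  IsKBoundedSober = ∀ F → IsClosed F → F ∈ Irr⁺ →
                    ∃! _≡_ (λ x → F ≐ cl ｛ x ｝)

  _≪_ : Rel Carrier (suc ℓ ⊔ o)
  x ≪ y = ∀ E (E∈Irr⁺ : E ∈ Irr⁺) → y ≤ ⋁ E∈Irr⁺ → Satisfiable (E ∩ ↑ x)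

  ↡ : Carrier → Pred Carrier (suc ℓ ⊔ o)
  ↡ x y = y ≪ x

  IsIrrContinuous : Set (suc ℓ ⊔ o)
  IsIrrContinuous = ∀ x → IsIrreducible (↡ x) × IsSup (↡ x) x

{-# OPTIONS --safe #-}

-- If an irreducible set E has a supremum s, then s is also the supremum of
-- cl E, which is closed and irreducible; k-bounded sobriety makes cl E the
-- closure of a point, which must be equivalent to s.  Hence s ∈ cl E.
-- In particular y ∈ cl (↡ y), so a closed set containing ↡ y contains y.
-- Therefore D = ⋃ { ↡ y | y ≪ x } is irreducible: a closed cover of D by A₁, A₂
-- splits each ↡ y, so it covers the irreducible set ↡ x.  The supremum of D
-- is x, and z ≪ x gives z ≤ w ≪ y ≪ x for some w and y.
module Submission where

open import Level using (Level; _⊔_; suc; Lift; lift; lower)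
open import Axiom.ExcludedMiddle using (ExcludedMiddle)
open import Data.Empty.Polymorphic using (⊥)
open import Data.Product using (∃-syntax; _×_; _,_; proj₁; proj₂)
open import Data.Sum using (_⊎_; inj₁; inj₂)
open import Function using (_∘_)
open import Relation.Binary.PropositionalEquality using (refl)
open import Relation.Nullary using (¬_; yes; no)
open import Relation.Nullary.Decidable using (True; toWitness; fromWitness; decidable-stable; map′)
open import Relation.Nullary.Negation using (contradiction)
open import Relation.Unary using (Pred; _∈_; _⊆_; _∪_; ∁; ⋃; ｛_｝)
open import Defs

module _ {ℓ o : Level} (X : TopologicalSpace ℓ o) where
  open TopologicalSpace X

  private
    infix 4 _≼_ _⋘_
    _≼_ = _≤_ X
    _⋘_ = _≪_ X

  ≤-refl : ∀ x → x ≼ x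
  ≤-refl x A _ x∈A = x∈A refl

  ≤-trans : ∀ {x y z} → x ≼ y → y ≼ z → x ≼ z
  ≤-trans x≤y y≤z A A-closed z∈A = x≤y A A-closed λ { refl → y≤z A A-closed z∈A }

  ⊆-cl : ∀ {e} (E : Pred Carrier e) → E ⊆ cl X E
  ⊆-cl _ x∈E _ _ E⊆A = E⊆A x∈E

  module _ {e f} {E : Pred Carrier e} {F : Pred Carrier f}
           (E⊆F : E ⊆ F) (F⊆clE : F ⊆ cl X E) where

    -- A closed set contains `E` exactly when it contains `F`. This serves twice: for passing from a
    -- set to its closure, and from a set to its copy at a lower universe level.
    IsIrreducible-⊆-cl : IsIrreducible X E → IsIrreducible X F
    IsIrreducible-⊆-cl ((x , x∈E) , split) = (x , E⊆F x∈E) , split′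
      where
      split′ : ∀ A₁ A₂ → IsClosed X A₁ → IsClosed X A₂ → F ⊆ A₁ ∪ A₂ → F ⊆ A₁ ⊎ F ⊆ A₂
      split′ A₁ A₂ c₁ c₂ F⊆A₁∪A₂ with split A₁ A₂ c₁ c₂ (λ y∈E → F⊆A₁∪A₂ (E⊆F y∈E))
      ... | inj₁ E⊆A₁ = inj₁ λ y∈F → F⊆clE y∈F A₁ c₁ E⊆A₁
      ... | inj₂ E⊆A₂ = inj₂ λ y∈F → F⊆clE y∈F A₂ c₂ E⊆A₂

    IsSup-⊆-cl : ∀ {s} → IsSup X E s → IsSup X F s
    IsSup-⊆-cl (upper , least) =
      -- A closed set containing `s` contains every `y ≼ s`, hence all of `E`, hence `F`.
      (λ x x∈F A c s∈A → F⊆clE x∈F A c λ {y} y∈E → upper y y∈E A c s∈A) ,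
      λ u F≤u → least u λ x x∈E → F≤u x (E⊆F x∈E)

  ｛｝-irreducible : ∀ x → IsIrreducible X ｛ x ｝
  ｛｝-irreducible x = (x , refl) , split
    where
    split : ∀ A₁ A₂ → IsClosed X A₁ → IsClosed X A₂ →
            ｛ x ｝ ⊆ A₁ ∪ A₂ → ｛ x ｝ ⊆ A₁ ⊎ ｛ x ｝ ⊆ A₂
    split _ _ _ _ x⊆A₁∪A₂ with x⊆A₁∪A₂ refl
    ... | inj₁ x∈A₁ = inj₁ λ { refl → x∈A₁ }
    ... | inj₂ x∈A₂ = inj₂ λ { refl → x∈A₂ }

  ｛｝-sup : ∀ x → IsSup X ｛ x ｝ x
  ｛｝-sup x = (λ { _ refl → ≤-refl x }) , λ u x≤u → x≤u x refl

  -- The singleton of `y` is an admissible test set with supremum `y`, and its only point is `y`.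
  ≪⇒≤ : ∀ {x y} → x ⋘ y → x ≼ y
  ≪⇒≤ {y = y} x≪y
    with _ , refl , x≤y ← x≪y ｛ y ｝ (｛｝-irreducible y , y , ｛｝-sup y) (≤-refl y) = x≤y

  ≪-≤-trans : ∀ {x y z} → x ⋘ y → y ≼ z → x ⋘ z
  ≪-≤-trans x≪y y≤z E E∈Irr⁺ z≤⋁E = x≪y E E∈Irr⁺ (≤-trans y≤z z≤⋁E)

  ≤-≪-trans : ∀ {x y z} → x ≼ y → y ⋘ z → x ⋘ z
  ≤-≪-trans x≤y y≪z E E∈Irr⁺ z≤⋁E with y≪z E E∈Irr⁺ z≤⋁E
  ... | w , w∈E , y≤w = w , w∈E , ≤-trans x≤y y≤w

  module _ (em : ExcludedMiddle (suc ℓ ⊔ o)) where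

    -- Excluded middle brings any subset down to the level at which the axioms
    -- of a topological space apply.
    resize : Pred Carrier (suc ℓ ⊔ o) → Pred Carrier ℓ
    resize P x = Lift ℓ (True (em {P x}))

    resize⁺ : ∀ P → P ⊆ resize P
    resize⁺ _ = lift ∘ fromWitness

    resize⁻ : ∀ P → resize P ⊆ P
    resize⁻ _ = toWitness ∘ lower

    em-ℓ : ExcludedMiddle ℓ
    em-ℓ {P} = map′ lower lift (em {Lift (suc ℓ ⊔ o) P})

    -- The collection of all closed supersets of `E` lives one universe too high to index `⋃-open`.
    -- Instead the union runs over points: each point outside the closure picks one closed superset
    -- of `E` that misses it, and contributes its complement.
    resize-cl-closed : ∀ (E : Pred Carrier (suc ℓ ⊔ o)) → IsClosed X (resize (cl X E))
    resize-cl-closed E = open-resp (⋃⊆∁ , ∁⊆⋃) (⋃-open Carrier V V-open)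
      where
      Separated : Carrier → Set (suc ℓ ⊔ o)
      Separated x = ∃[ A ] (IsClosed X A × E ⊆ A × ¬ A x)

      V : Carrier → Pred Carrier ℓ
      V x with em {Separated x}
      ... | yes (A , _) = ∁ A
      -- Points of the closure contribute nothing to the union.
      ... | no _        = λ _ → ⊥

      V-open : ∀ x → IsOpen (V x)
      V-open x with em {Separated x}
      ... | yes (_ , A-closed , _) = A-closed
      ... | no _ = open-resp ((λ ()) , λ ()) (⋃-open ⊥ (λ ()) λ ())

      ⋃⊆∁ : ⋃ Carrier V ⊆ ∁ (resize (cl X E))
      ⋃⊆∁ (i , x∈Vi) x∈cl with em {Separated i}
      ⋃⊆∁ (i , x∉A) x∈cl | yes (A , A-closed , E⊆A , _) = x∉A (resize⁻ (cl X E) x∈cl A A-closed E⊆A)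

      ∈V : ∀ {x} → Separated x → x ∈ V x
      ∈V {x} s with em {Separated x}
      ... | yes (_ , _ , _ , x∉A) = x∉A
      ... | no ¬s = contradiction s ¬s

      inseparable⇒∈cl : ∀ {x} → ¬ Separated x → x ∈ cl X E
      inseparable⇒∈cl ¬s A A-closed E⊆A =
        decidable-stable em-ℓ λ x∉A → ¬s (A , A-closed , E⊆A , x∉A)

      ∁⊆⋃ : ∁ (resize (cl X E)) ⊆ ⋃ Carrier V
      ∁⊆⋃ {x} x∉cl = x , ∈V (decidable-stable em λ ¬s →
        x∉cl (resize⁺ (cl X E) (inseparable⇒∈cl ¬s)))

    module _ (sober : IsKBoundedSober X) where

      sup∈cl : ∀ {E : Pred Carrier (suc ℓ ⊔ o)} {s} →
               IsIrreducible X E → IsSup X E s → s ∈ cl X E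
      sup∈cl {E} {s} E-irr E-sup = resize⁻ (cl X E) (cl-p⊆F s≤p)
        where
        F = resize (cl X E)
        E⊆F : E ⊆ F
        E⊆F x∈E = resize⁺ (cl X E) (⊆-cl E x∈E)
        F⊆cl = resize⁻ (cl X E)
        F-irr = IsIrreducible-⊆-cl E⊆F F⊆cl E-irr
        F-sup = IsSup-⊆-cl E⊆F F⊆cl E-sup
        generic = sober F (resize-cl-closed E) (F-irr , s , F-sup)
        p = proj₁ generic
        F⊆cl-p = proj₁ (proj₁ (proj₂ generic))
        cl-p⊆F = proj₂ (proj₁ (proj₂ generic))
        s≤p : s ≼ p
        -- `F ⊆ cl ｛ p ｝` says that `p` is an upper bound of `F`, so the least one lies below it. As
        -- `s ≼ p` means `s ∈ cl ｛ p ｝`, this puts `s` in `F`.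
        s≤p = proj₂ F-sup p λ _ → F⊆cl-p

      module _ (continuous : IsIrrContinuous X) where

        ↡↡ : Carrier → Pred Carrier (suc ℓ ⊔ o)
        ↡↡ x w = ∃[ y ] (w ⋘ y × y ⋘ x)

        ↡⊆⇒∈ : ∀ {y A} → IsClosed X A → ↡ X y ⊆ A → y ∈ A
        ↡⊆⇒∈ {y} {A} A-closed = sup∈cl (proj₁ (continuous y)) (proj₂ (continuous y)) A A-closed

        ↡↡-irreducible : ∀ x → IsIrreducible X (↡↡ x)
        ↡↡-irreducible x = satisfiable , split
          where
          satisfiable : ∃[ w ] ↡↡ x w
          satisfiable with proj₁ (proj₁ (continuous x))
          ... | y , y≪x with proj₁ (proj₁ (continuous y))
          ...   | w , w≪y = w , y , w≪y , y≪x

          ↡↡⊆↡ : ↡↡ x ⊆ ↡ X x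
          ↡↡⊆↡ (_ , w≪y , y≪x) = ≪-≤-trans w≪y (≪⇒≤ y≪x)

          ↡-covered : ∀ A₁ A₂ → IsClosed X A₁ → IsClosed X A₂ →
                      ↡↡ x ⊆ A₁ ∪ A₂ → ↡ X x ⊆ A₁ ∪ A₂
          ↡-covered A₁ A₂ c₁ c₂ ↡↡⊆A₁∪A₂ {y} y≪x
            with proj₂ (proj₁ (continuous y)) A₁ A₂ c₁ c₂
                   (λ w≪y → ↡↡⊆A₁∪A₂ (y , w≪y , y≪x))
          ... | inj₁ ↡y⊆A₁ = inj₁ (↡⊆⇒∈ c₁ ↡y⊆A₁)
          ... | inj₂ ↡y⊆A₂ = inj₂ (↡⊆⇒∈ c₂ ↡y⊆A₂)

          split : ∀ A₁ A₂ → IsClosed X A₁ → IsClosed X A₂ →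
                  ↡↡ x ⊆ A₁ ∪ A₂ → ↡↡ x ⊆ A₁ ⊎ ↡↡ x ⊆ A₂
          split A₁ A₂ c₁ c₂ ↡↡⊆A₁∪A₂
            -- Whichever of the two closed sets contains `↡ X x` also contains its subset `↡↡ x`.
            with proj₂ (proj₁ (continuous x)) A₁ A₂ c₁ c₂ (↡-covered A₁ A₂ c₁ c₂ ↡↡⊆A₁∪A₂)
          ... | inj₁ ↡x⊆A₁ = inj₁ λ w∈ → ↡x⊆A₁ (↡↡⊆↡ w∈)
          ... | inj₂ ↡x⊆A₂ = inj₂ λ w∈ → ↡x⊆A₂ (↡↡⊆↡ w∈)

        -- Suprema are taken in two stages: an upper bound of `↡↡ x` bounds `↡ X y` for each
        -- `y ⋘ x`, so it lies above each such `y`, and hence above `x`.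
        ↡↡-sup : ∀ x → IsSup X (↡↡ x) x
        ↡↡-sup x =
          (λ { w (y , w≪y , y≪x) → ≤-trans (≪⇒≤ w≪y) (≪⇒≤ y≪x) }) ,
          λ u ↡↡≤u → proj₂ (proj₂ (continuous x)) u λ y y≪x →
            proj₂ (proj₂ (continuous y)) u λ w w≪y → ↡↡≤u w (y , w≪y , y≪x)

        ≪-interpolation : ∀ x z → z ⋘ x → ∃[ y ] (z ⋘ y × y ⋘ x)
        ≪-interpolation x z z≪x =
          -- `_⋘_` only tests sets at level `ℓ`, so `z ⋘ x` is applied to the resized copy `F` of
          -- `↡↡ x`, whose supremum is `x` itself.
          let w , w∈F , z≤w = z≪x F F∈Irr⁺ (≤-refl x)
              y , w≪y , y≪x = resize⁻ (↡↡ x) w∈F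
          in  y , ≤-≪-trans z≤w w≪y , y≪x
          where
          F = resize (↡↡ x)
          E⊆F = resize⁺ (↡↡ x)
          F⊆cl : F ⊆ cl X (↡↡ x)
          F⊆cl w∈F = ⊆-cl (↡↡ x) (resize⁻ (↡↡ x) w∈F)
          F∈Irr⁺ : Irr⁺ X F
          F∈Irr⁺ = IsIrreducible-⊆-cl E⊆F F⊆cl (↡↡-irreducible x) ,
                   x , IsSup-⊆-cl E⊆F F⊆cl (↡↡-sup x)

theorem3p5 : {ℓ o : Level} → ExcludedMiddle (suc ℓ ⊔ o) →
    (X : TopologicalSpace ℓ o) → IsT₀ X → IsIrrContinuous X → IsKBoundedSober X →
    ∀ x z → _≪_ X z x → ∃[ y ] (_≪_ X z y × _≪_ X y x)
theorem3p5 em X _ continuous sober = ≪-interpolation X em sober continuous
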